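{- Let $D$ be a dcpo with an apartness relation $\sharp$. (i) If $D$ has elements $x\sqsubset y$ (i.e. $x$ strictly below $y$), then tightness of $\sharp$ implies excluded middle. (ii) If $D$ has elements $x\sqsubseteq y$ with $x\mathrel{\sharp}y$, then cotransitivity of $\sharp$ implies weak excluded middle.
   Context: Everything is constructive: neither excluded middle nor choice is assumed. Excluded middle: $P\vee\lnot P$ for every proposition $P$. Weak excluded middle: $\lnot P\vee\lnot\lnot P$ for every proposition $P$. A subset $S$ of a poset is directed if it is inhabited and any two elements of $S$ have an upper bound in $S$. A dcpo is a poset $(D,\sqsubseteq)$ in which every directed subset $S$ has a supremum $\bigsqcup S$. An apartness on a set $X$ is merely an irreflexive and symmetric binary relation $\sharp$ on $X$. It is tight if $\lnot(x\mathrel{\sharp}y)$ implies $x=y$ for all $x,y\in X$; it is cotransitive if $x\mathrel{\sharp}y$ implies $x\mathrel{\sharp}z$ or $y\mathrel{\sharp}z$ for all $x,y,z\in X$. For elements of a dcpo $D$, $x$ is strictly below $y$, written $x\sqsubset y$, if $x\sqsubseteq y$ and for every $z\in D$ with $y\sqsubseteq z$ and every proposition $P$, the equality $z=\bigsqcup(\{x\}\cup\{z\mid P\})$ implies $P$. Here $\{z\mid P\}$ is the set whose elements are those $w$ with $w=z$ and $P$ true; the set $\{x\}\cup\{z\mid P\}$ is directed since $x\sqsubseteq z$. -}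

module Defs where

open import Level using (Level; _⊔_; suc)
open import Data.Product using (Σ; Σ-syntax; ∃; ∃-syntax; _×_; _,_; proj₁; proj₂)
open import Data.Sum using (_⊎_; inj₁; inj₂)
open import Data.Unit.Polymorphic using (⊤; tt)
open import Relation.Binary using (Rel; Poset; Irreflexive; Symmetric; _Respects₂_; _Respects_)
open import Relation.Nullary using (¬_)
open import Relation.Unary using (Pred; _∈_; _∪_; _≐_; Satisfiable)

-- Propositions are types, and the equality of a poset is its setoid equality
-- _≈_.  The level u is that of the propositions over which excluded middle and
-- the strictly-below relation quantify.

module _ {c ℓ₁ ℓ₂} (P : Poset c ℓ₁ ℓ₂) where

  open Poset P using (Carrier; _≈_; module Eq) renaming (_≤_ to _⊑_)

  record IsDirected {s} (S : Pred Carrier s) : Set (c ⊔ ℓ₂ ⊔ s) where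
    field
      inhabited  : Satisfiable S
      upperBound : ∀ {a b} → a ∈ S → b ∈ S → ∃[ d ] (d ∈ S × a ⊑ d × b ⊑ d)

  record IsSupremum {s} (S : Pred Carrier s) (t : Carrier) : Set (c ⊔ ℓ₂ ⊔ s) where
    field
      upper : ∀ {a} → a ∈ S → a ⊑ t
      least : ∀ b → (∀ {a} → a ∈ S → a ⊑ b) → t ⊑ b

  -- A predicate is a subset of size u if it is the image of a family indexed
  -- by a type in Set u; in particular it then respects _≈_.

  IsSubset : ∀ u {s} → Pred Carrier s → Set (c ⊔ ℓ₁ ⊔ s ⊔ suc u)
  IsSubset u S =
    Σ[ I ∈ Set u ] Σ[ α ∈ (I → Carrier) ] (S ≐ λ w → ∃[ k ] w ≈ α k)

  -- If u is at least the levels of the carrier and of the predicate, the size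
  -- condition says nothing beyond respecting _≈_.

  respects⇒isSubset : ∀ u {S : Pred Carrier (c ⊔ u)} →
                      S Respects _≈_ → IsSubset (c ⊔ u) S
  respects⇒isSubset _ {S} resp =
    Σ Carrier S , proj₁ ,
    (λ {w} w∈S → (w , w∈S) , Eq.refl) ,
    (λ { ((_ , v∈S) , w≈v) → resp (Eq.sym w≈v) v∈S })

-- Completeness is demanded only for subsets of size u because Agda is
-- predicative: the poset of propositions Set u has carrier in Set (suc u), and
-- has suprema of families indexed by types in Set u but not of arbitrary
-- predicates on its carrier.  The level u ⊔ ℓ₁ is that of the image of a family
-- indexed by a type in Set u.

record DCPO c ℓ₁ ℓ₂ u : Set (suc (c ⊔ ℓ₁ ⊔ ℓ₂ ⊔ u)) where
  field
    poset : Poset c ℓ₁ ℓ₂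

  open Poset poset public renaming (_≤_ to _⊑_)

  field
    directedComplete : (S : Pred Carrier (u ⊔ ℓ₁)) → IsSubset poset u S →
                       IsDirected poset S → ∃[ t ] IsSupremum poset S t

  ⨆ : (S : Pred Carrier (u ⊔ ℓ₁)) → IsSubset poset u S →
      IsDirected poset S → Carrier
  ⨆ S S-subset S-directed = proj₁ (directedComplete S S-subset S-directed)

  ｛_｝∪｛_∣_｝ : Carrier → Carrier → Set u → Pred Carrier (u ⊔ ℓ₁)
  ｛ x ｝∪｛ z ∣ P ｝ = (λ w → w ≈ x) ∪ (λ w → w ≈ z × P)

  pair-isSubset : ∀ x z (P : Set u) → IsSubset poset u ｛ x ｝∪｛ z ∣ P ｝
  pair-isSubset x z P = (⊤ {u} ⊎ P) , α , to , from
    where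
    α : ⊤ {u} ⊎ P → Carrier
    α (inj₁ _) = x
    α (inj₂ _) = z

    to : ∀ {w} → w ∈ ｛ x ｝∪｛ z ∣ P ｝ → ∃[ k ] w ≈ α k
    to (inj₁ w≈x)       = inj₁ tt , w≈x
    to (inj₂ (w≈z , p)) = inj₂ p , w≈z

    from : ∀ {w} → ∃[ k ] w ≈ α k → w ∈ ｛ x ｝∪｛ z ∣ P ｝
    from (inj₁ _ , w≈x) = inj₁ w≈x
    from (inj₂ p , w≈z) = inj₂ (w≈z , p)

  pair-isDirected : ∀ {x z} → x ⊑ z → (P : Set u) →
                    IsDirected poset ｛ x ｝∪｛ z ∣ P ｝
  pair-isDirected {x} {z} x⊑z P = record
    { inhabited  = x , inj₁ Eq.refl
    ; upperBound = ub
    }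
    where
    S = ｛ x ｝∪｛ z ∣ P ｝

    below : ∀ {a} → a ∈ S → a ⊑ z
    below (inj₁ a≈x)       = trans (reflexive a≈x) x⊑z
    below (inj₂ (a≈z , _)) = reflexive a≈z

    ub : ∀ {a b} → a ∈ S → b ∈ S → ∃[ d ] (d ∈ S × a ⊑ d × b ⊑ d)
    ub (inj₁ a≈x) (inj₁ b≈x) =
      x , inj₁ Eq.refl , reflexive a≈x , reflexive b≈x
    ub a∈S (inj₂ (b≈z , p)) =
      z , inj₂ (Eq.refl , p) , below a∈S , reflexive b≈z
    ub (inj₂ (a≈z , p)) b∈S =
      z , inj₂ (Eq.refl , p) , reflexive a≈z , below b∈S

  infix 4 _⊏_

  _⊏_ : Carrier → Carrier → Set (c ⊔ ℓ₁ ⊔ ℓ₂ ⊔ suc u)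
  x ⊏ y = Σ[ x⊑y ∈ x ⊑ y ]
    (∀ z (y⊑z : y ⊑ z) (P : Set u) →
     z ≈ ⨆ ｛ x ｝∪｛ z ∣ P ｝ (pair-isSubset x z P) (pair-isDirected (trans x⊑y y⊑z) P) →
     P)

-- Unlike the library's IsApartnessRelation, cotransitivity is not included.

record IsApartness {a ℓ r} {A : Set a} (_≈_ : Rel A ℓ) (_♯_ : Rel A r) :
                   Set (a ⊔ ℓ ⊔ r) where
  field
    resp   : _♯_ Respects₂ _≈_
    irrefl : Irreflexive _≈_ _♯_
    sym    : Symmetric _♯_

WeakExcludedMiddle : ∀ ℓ → Set (suc ℓ)
WeakExcludedMiddle ℓ = {P : Set ℓ} → ¬ P ⊎ ¬ ¬ P

{-# OPTIONS --safe #-}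

-- For x ⊑ y and a proposition P, let s be the supremum of {x} ∪ {y ∣ P}: it is y
-- if P holds and x if P fails.  For (i), take P to be an instance Q ∨ ¬ Q of
-- excluded middle: since ¬ ¬ P, s is not apart from y, so tightness gives y = s,
-- and then x ⊏ y gives P.  For (ii), cotransitivity applied to x ♯ y gives
-- x ♯ s, which refutes ¬ P, or s ♯ y, which refutes P.
module Submission where

open import Defs
open import Axiom.ExcludedMiddle using (ExcludedMiddle)
open import Data.Empty using (⊥-elim)
open import Data.Product using (∃₂; _×_; _,_; proj₁; proj₂)
open import Data.Sum using (inj₁; inj₂)
open import Relation.Binary using (Rel; Tight; Cotransitive)
open import Relation.Nullary using (¬_; Dec)
open import Relation.Nullary.Decidable using (¬¬-excluded-middle)

module _ {c ℓ₁ ℓ₂ u} (D : DCPO c ℓ₁ ℓ₂ u) where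

  open DCPO D

  module _ {x y} (x⊑y : x ⊑ y) (P : Set u) where

    -- The supremum exists without a decision of `P`, so its apartness from `x` or `y` carries
    -- information about `P`.
    pair-⨆ : Carrier
    pair-⨆ = ⨆ ｛ x ｝∪｛ y ∣ P ｝ (pair-isSubset x y P) (pair-isDirected x⊑y P)

    private
      open module Sup = IsSupremum
        (proj₂ (directedComplete ｛ x ｝∪｛ y ∣ P ｝ (pair-isSubset x y P) (pair-isDirected x⊑y P)))

    pair-⨆≈upper : P → pair-⨆ ≈ y
    pair-⨆≈upper p = antisym
      (least y λ { (inj₁ a≈x)       → trans (reflexive a≈x) x⊑y
                 ; (inj₂ (a≈y , _)) → reflexive a≈y })
      (upper (inj₂ (Eq.refl , p)))

    pair-⨆≈lower : ¬ P → pair-⨆ ≈ x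
    pair-⨆≈lower ¬p = antisym
      (least x λ { (inj₁ a≈x)     → reflexive a≈x
                 ; (inj₂ (_ , p)) → ⊥-elim (¬p p) })
      (upper (inj₁ Eq.refl))

  module _ {r} {_♯_ : Rel Carrier r} (♯-isApartness : IsApartness _≈_ _♯_) where

    open IsApartness ♯-isApartness using (irrefl)

    tight⇒excludedMiddle : ∀ {x y} → x ⊏ y → Tight _≈_ _♯_ → ExcludedMiddle u
    tight⇒excludedMiddle {x} {y} (x⊑y , strict) tight {Q} =
      -- The upper element `z` is `y` itself; the first half of `Tight` turns non-apartness into
      -- equality.
      strict y refl (Dec Q) (proj₁ (tight y _) ¬y♯s)
      where
      -- The definition of ⊏ supplies the bound x ⊑ z as this composite.
      x⊑z = trans x⊑y refl

      ¬y♯s : ¬ (y ♯ pair-⨆ x⊑z (Dec Q))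
      -- The goal is absurdity, so the irrefutable `Dec Q` may be assumed.
      ¬y♯s y♯s = ¬¬-excluded-middle λ q? →
        irrefl (Eq.sym (pair-⨆≈upper x⊑z (Dec Q) q?)) y♯s

    cotransitive⇒weakExcludedMiddle : ∀ {x y} → x ⊑ y → x ♯ y →
                                      Cotransitive _♯_ → WeakExcludedMiddle u
    cotransitive⇒weakExcludedMiddle x⊑y x♯y cotrans {P}
      with cotrans x♯y (pair-⨆ x⊑y P)
    -- Were `P` false, `x` would be apart from itself.
    ... | inj₁ x♯s = inj₂ λ ¬p → irrefl (Eq.sym (pair-⨆≈lower x⊑y P ¬p)) x♯s
    ... | inj₂ s♯y = inj₁ λ p → irrefl (pair-⨆≈upper x⊑y P p) s♯y

theorem5p6 : ∀ {c ℓ₁ ℓ₂ u r} (D : DCPO c ℓ₁ ℓ₂ u) → let open DCPO D in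
    (_♯_ : Rel Carrier r) → IsApartness _≈_ _♯_ →
    (∃₂ (λ x y → x ⊏ y) →
    Tight _≈_ _♯_ → ExcludedMiddle u)
    ×
    (∃₂ (λ x y → x ⊑ y × x ♯ y) →
    Cotransitive _♯_ → WeakExcludedMiddle u)
theorem5p6 D _♯_ ap =
  (λ { (_ , _ , x⊏y) tight → tight⇒excludedMiddle D ap x⊏y tight }) ,
  (λ { (_ , _ , x⊑y , x♯y) cotrans →
       cotransitive⇒weakExcludedMiddle D ap x⊑y x♯y cotrans })
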